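{- Let $n\ge 4$ and let $\mathcal{G}=\{G_1,G_2,\ldots,G_n\}$ be a family of $n$ graphs, all on the same vertex set $[n]=\{1,\ldots,n\}$, such that $e(G_i)>\binom{n-1}{2}+1$ for every $i=1,2,\ldots,n$. Then $\mathcal{G}$ admits a rainbow Hamiltonian cycle.
   Context: $e(G)$ denotes the number of edges of $G$. Given a family $\mathcal{G}=\{G_1,\ldots,G_n\}$ of graphs on a common vertex set $V$ with $|V|=n$, a rainbow Hamiltonian cycle in $\mathcal{G}$ is a Hamiltonian cycle $C$ on $V$ (a cycle visiting every vertex exactly once, so it has $n$ edges) whose edges can be labeled $e_1,\ldots,e_n$ with $e_i\in E(G_i)$ for each $i$; i.e. distinct edges of $C$ belong to distinct graphs of the family, each graph used once. -}

module Defs where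

open import Data.Fin.Base using (Fin; toℕ; _<_)
open import Data.Fin.Permutation using (Permutation′; _⟨$⟩ʳ_)
open import Data.Fin.Properties using (_<?_)
open import Data.List.Base using (List; allFin; cartesianProduct; filter; length)
open import Data.Nat.Base as ℕ using (ℕ; suc)
open import Data.Nat.DivMod using (_mod_)
open import Data.Product.Base using (_×_; _,_; uncurry)
open import Level using (0ℓ)
open import Relation.Binary.Core using (Rel)
open import Relation.Binary.Definitions using (Decidable; Irreflexive; Symmetric)
open import Relation.Binary.PropositionalEquality.Core using (_≡_)
open import Relation.Nullary.Decidable using (_×-dec_)

-- Finite simple graphs on the vertex set [n], represented by Fin n.
-- Adjacency is decidable so that edges can be counted constructively.
record Graph (n : ℕ) : Set₁ where
  field
    Adj    : Rel (Fin n) 0ℓ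
    adj?   : Decidable Adj
    sym    : Symmetric Adj
    irrefl : Irreflexive _≡_ Adj

-- Each edge {u , v} is listed exactly once, as the pair with u < v.
edges : ∀ {n} → Graph n → List (Fin n × Fin n)
edges {n} G =
  filter (λ (u , v) → (u <? v) ×-dec Graph.adj? G u v)
         (cartesianProduct (allFin n) (allFin n))

e : ∀ {n} → Graph n → ℕ
e G = length (edges G)

-- The cyclic successor: i + 1 modulo n.
next : ∀ {n} → Fin n → Fin n
next {suc m} i = suc (toℕ i) mod suc m

-- A cycle through all n vertices, given by the order in which it visits
-- them.  A cycle needs at least three vertices: without that condition,
-- n = 2 would traverse a single edge twice.
record HamiltonianCycle (n : ℕ) : Set where
  field
    3≤n   : 3 ℕ.≤ n
    order : Permutation′ n

  vertex : Fin n → Fin n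
  vertex k = order ⟨$⟩ʳ k

  edge : Fin n → Fin n × Fin n
  edge k = vertex k , vertex (next k)

-- The permutation sends i to the position in the cycle of the edge
-- labelled eᵢ, so each graph of the family is used for exactly one edge.
record RainbowHamiltonianCycle {n : ℕ} (G : Fin n → Graph n) : Set where
  field
    cycle    : HamiltonianCycle n
    labeling : Permutation′ n

  open HamiltonianCycle cycle public

  field
    rainbow : ∀ i → uncurry (Graph.Adj (G i)) (edge (labeling ⟨$⟩ʳ i))

{-# OPTIONS --safe #-}
-- Every Gᵢ misses at most n - 3 edges.  Let the weight w(uv) be the number of indices i with
-- uv ∉ Gᵢ, so that the pairs of vertices have total weight at most n (n - 3).  Inserting the
-- vertices one after the other at a place of at most average cost gives a Hamiltonian cycle whose
-- weight is at most 2n (n - 3) / (n - 1), hence at most 2n - 5.  If one of its edges ab has weight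
-- n, the other edges have weight at most n - 5 together, and averaging over the n - 3 exchanges
-- of ab and a non-adjacent edge pq for pa and qb gives a cycle of weight at most 2n - 5 all of
-- whose edges have weight less than n.  Matching the graphs with the edges of this cycle, König's
-- obstruction to a perfect matching is an s × (n + 1 - s) block of missing edges, and
-- s (n + 1 - s) ≤ 2n - 5 forces s = 1 or s = n: a graph that misses n edges or an edge of weight n.
module Submission where

open import Defs
open import Data.Bool.Base using (true; false; if_then_else_)
open import Data.Fin.Base as Fin using (Fin; zero; suc; inject₁; fromℕ)
open import Data.Fin.Permutation as Perm using (Permutation′; permutation; _⟨$⟩ʳ_; _⟨$⟩ˡ_; _∘ₚ_; inverseʳ)
import Data.Fin.Properties as Fin
open import Data.List.Base using
  (List; []; _∷_; [_]; _++_; map; length; reverse; lookup; tabulate; allFin; filter; cartesianProduct)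
open import Data.List.Membership.Propositional using (_∈_)
open import Data.List.Membership.Propositional.Properties using (∈-tabulate⁻; ∈-allFin)
open import Data.List.Properties using
  (map-++; map-∘; map-tabulate; length-map; length-++; length-tabulate; tabulate-cong; tabulate-lookup;
   ++-assoc; unfold-reverse; ∷-injective)
open import Data.List.Relation.Binary.Permutation.Propositional using
  (_↭_; refl; prep; swap; trans; ↭-refl; ↭-sym; ↭-trans; ↭-reflexive; ↭⇒↭ₛ)
open import Data.List.Relation.Binary.Permutation.Propositional.Properties using
  (map⁺; ↭-length; ++-comm; ++⁺ˡ; ↭-reverse; All-resp-↭; ∈-resp-↭)
import Data.List.Relation.Binary.Permutation.Setoid.Properties as Permutationₛ
open import Data.List.Relation.Unary.All as All using (All; []; _∷_)
import Data.List.Relation.Unary.All.Properties as All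
open import Data.List.Relation.Unary.AllPairs using (AllPairs; []; _∷_)
import Data.List.Relation.Unary.AllPairs.Properties as AllPairs
open import Data.List.Relation.Unary.Any using (here; there)
open import Data.List.Relation.Unary.Unique.Propositional using (Unique)
open import Data.List.Relation.Unary.Unique.Propositional.Properties using (allFin⁺)
open import Data.Nat.Base using (ℕ; zero; suc; _+_; _*_; _∸_; _≤_; _<_; z≤n; s≤s; z<s; s≤s⁻¹)
open import Data.Nat.Combinatorics using (_C_; nC1≡n; nCk+nC[k+1]≡[n+1]C[k+1])
open import Data.Nat.DivMod using (_%_; m<n⇒m%n≡m; n%n≡0)
open import Data.Nat.ListAction using (sum)
open import Data.Nat.ListAction.Properties using (sum-↭; sum-++)
open import Data.Nat.Properties
open import Algebra.Properties.CommutativeSemigroup +-commutativeSemigroup using (interchange)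
open import Data.Nat.Tactic.RingSolver using (solve-∀)
open import Data.Product.Base as Product using (_×_; _,_; proj₁; proj₂; ∃-syntax; uncurry)
open import Data.Sum.Base using (_⊎_; inj₁; inj₂)
open import Function.Base using (flip; _∘_; id)
open import Relation.Binary.PropositionalEquality as ≡
  using (_≡_; cong; cong₂; sym; subst; module ≡-Reasoning)
open import Relation.Nullary using (¬_; Dec; does; yes; no; ¬?; contradiction)
open import Relation.Nullary.Decidable using (_×-dec_; dec-false)
open import Relation.Unary using (Decidable)

private variable
  A I J : Set
  m n : ℕ

-- Sums over lists

∑ : List A → (A → ℕ) → ℕ
∑ xs f = sum (map f xs)

∑-cong : ∀ {f g : A → ℕ} xs → (∀ x → f x ≡ g x) → ∑ xs f ≡ ∑ xs g
∑-cong []       eq = ≡.refl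
∑-cong (x ∷ xs) eq = cong₂ _+_ (eq x) (∑-cong xs eq)

∑-mono-≤ : ∀ {f g : A → ℕ} {xs} → All (λ x → f x ≤ g x) xs → ∑ xs f ≤ ∑ xs g
∑-mono-≤ []        = z≤n
∑-mono-≤ (le ∷ ps) = +-mono-≤ le (∑-mono-≤ ps)

∑-const : ∀ k (xs : List A) → ∑ xs (λ _ → k) ≡ length xs * k
∑-const k []       = ≡.refl
∑-const k (x ∷ xs) = cong (k +_) (∑-const k xs)

∑-≤-const : ∀ {f : A → ℕ} {k xs} → All (λ x → f x ≤ k) xs → ∑ xs f ≤ length xs * k
∑-≤-const {k = k} {xs} ps = ≤-trans (∑-mono-≤ ps) (≤-reflexive (∑-const k xs))

∑-≡0 : ∀ {f : A → ℕ} {xs} → All (λ x → f x ≤ 0) xs → ∑ xs f ≡ 0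
∑-≡0 {xs = xs} ps = n≤0⇒n≡0 (≤-trans (∑-≤-const ps) (≤-reflexive (*-zeroʳ (length xs))))

∑-+ : ∀ (f g : A → ℕ) xs → ∑ xs (λ x → f x + g x) ≡ ∑ xs f + ∑ xs g
∑-+ f g []       = ≡.refl
∑-+ f g (x ∷ xs) = ≡.trans (cong (f x + g x +_) (∑-+ f g xs)) (interchange (f x) (g x) (∑ xs f) (∑ xs g))

∑-↭ : ∀ (f : A → ℕ) {xs ys} → xs ↭ ys → ∑ xs f ≡ ∑ ys f
∑-↭ f p = sum-↭ (map⁺ f p)

∑-++ : ∀ (f : A → ℕ) xs ys → ∑ (xs ++ ys) f ≡ ∑ xs f + ∑ ys f
∑-++ f xs ys = ≡.trans (cong sum (map-++ f xs ys)) (sum-++ (map f xs) (map f ys))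

∑-swap : ∀ (f : A → I → ℕ) xs ys →
         ∑ xs (λ x → ∑ ys (f x)) ≡ ∑ ys (λ y → ∑ xs (λ x → f x y))
∑-swap f []       ys = sym (≡.trans (∑-const 0 ys) (*-zeroʳ (length ys)))
∑-swap f (x ∷ xs) ys =
  ≡.trans (cong (∑ ys (f x) +_) (∑-swap f xs ys)) (sym (∑-+ (f x) _ ys))

head-≤-∑ : ∀ (f : A → ℕ) {x xs ys} → xs ↭ x ∷ ys → f x ≤ ∑ xs f
head-≤-∑ f p = ≤-trans (m≤m+n _ _) (≤-reflexive (sym (∑-↭ f p)))

extract : ∀ {P : A → Set} → Decidable P → ∀ xs →
          (∃[ x ] ∃[ ys ] xs ↭ x ∷ ys × P x) ⊎ All (¬_ ∘ P) xs
extract P? []       = inj₂ []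
extract P? (x ∷ xs) with P? x | extract P? xs
... | yes px | _                       = inj₁ (x , xs , ↭-refl , px)
... | no ¬px | inj₁ (y , ys , p , py) = inj₁ (y , x ∷ ys , trans (prep x p) (swap x y refl) , py)
... | no ¬px | inj₂ ¬ps               = inj₂ (¬px ∷ ¬ps)

-- Pigeonhole: if no entry were zero, the sum would be at least the length.
extract-zero : ∀ (f : A → ℕ) xs → ∑ xs f < length xs →
               ∃[ x ] ∃[ ys ] xs ↭ x ∷ ys × f x ≡ 0
extract-zero f (x ∷ xs) lt with f x in eq
... | zero  = x , xs , ↭-refl , eq
... | suc k =
  let y , ys , p , fy≡0 = extract-zero f xs (≤-trans (s≤s (m≤n+m _ k)) (s≤s⁻¹ lt))
  in  y , x ∷ ys , trans (prep x p) (swap x y refl) , fy≡0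

-- Perfect matchings on the zeros of a matrix

total : (I → J → ℕ) → List I → List J → ℕ
total B cs es = ∑ cs (λ c → ∑ es (B c))

-- A list of pairs instead of a bijection: it grows by one pair at a time, and the two index lists
-- matter only up to `↭`, so lines of the matrix can be deleted freely.
Matching : (I → J → ℕ) → List I → List J → Set
Matching B cs es =
  ∃[ ps ] map proj₁ ps ↭ cs × map proj₂ ps ↭ es × All (λ p → B (proj₁ p) (proj₂ p) ≡ 0) ps

matching-∷ : ∀ (B : I → J → ℕ) {cs es c e cs′ es′} → cs ↭ c ∷ cs′ → es ↭ e ∷ es′ → B c e ≡ 0 →
             Matching B cs′ es′ → Matching B cs es
matching-∷ B p q B≡0 (ps , p′ , q′ , zs) =
  _ ∷ ps , trans (prep _ p′) (↭-sym p) , trans (prep _ q′) (↭-sym q) , B≡0 ∷ zs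

-- Row `c` and column `e` overlap only in the entry `B c e`. As it is zero, counting it twice does
-- no harm and the total splits exactly.
total-remove : ∀ (B : I → J → ℕ) {cs es c e cs′ es′} → cs ↭ c ∷ cs′ → es ↭ e ∷ es′ → B c e ≡ 0 →
               total B cs es ≡ ∑ es (B c) + ∑ cs (λ c → B c e) + total B cs′ es′
total-remove B {cs} {es} {c} {e} {cs′} {es′} p q B≡0 = begin
  total B cs es
    ≡⟨ ∑-↭ _ p ⟩
  ∑ es (B c) + ∑ cs′ (λ c → ∑ es (B c))
    ≡⟨ cong (∑ es (B c) +_) (∑-cong cs′ (λ c → ∑-↭ (B c) q)) ⟩
  ∑ es (B c) + ∑ cs′ (λ c → B c e + ∑ es′ (B c))
    ≡⟨ cong (∑ es (B c) +_) (∑-+ _ _ cs′) ⟩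
  ∑ es (B c) + (∑ cs′ (λ c → B c e) + total B cs′ es′)
    ≡⟨ +-assoc (∑ es (B c)) _ _ ⟨
  ∑ es (B c) + ∑ cs′ (λ c → B c e) + total B cs′ es′
    ≡⟨ cong (λ k → ∑ es (B c) + (k + ∑ cs′ (λ c → B c e)) + total B cs′ es′) B≡0 ⟨
  ∑ es (B c) + (B c e + ∑ cs′ (λ c → B c e)) + total B cs′ es′
    ≡⟨ cong (λ k → ∑ es (B c) + k + total B cs′ es′) (∑-↭ (λ c → B c e) p) ⟨
  ∑ es (B c) + ∑ cs (λ c → B c e) + total B cs′ es′
    ∎
  where open ≡-Reasoning

length-∷ : ∀ {xs ys : List A} {x n} → length xs ≡ suc n → xs ↭ x ∷ ys → length ys ≡ n
length-∷ eq p = suc-injective (≡.trans (sym (↭-length p)) eq)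

-- A nonzero column has sum below `n`, so by pigeonhole it contains a zero. Matching there deletes
-- weight at least 1, which keeps the bound for the smaller matrix.
matching-sparse : ∀ n (B : I → J → ℕ) cs es → length cs ≡ n → length es ≡ n →
                  total B cs es ≤ n ∸ 1 → Matching B cs es
matching-sparse zero    B [] [] _ _ _ = [] , refl , refl , []
matching-sparse (suc m) B cs es@(e₀ ∷ es₀) #cs #es T≤m
  with extract (λ e → 1 ≤? ∑ cs (λ c → B c e)) es
... | inj₁ (e , es′ , q , 1≤col) =
  let c , cs′ , p , B≡0 = extract-zero (λ c → B c e) cs (begin-strict
        ∑ cs (λ c → B c e)                    ≤⟨ head-≤-∑ (λ e → ∑ cs (λ c → B c e)) q ⟩
        total′                                ≡⟨ ∑-swap B cs es ⟨
        total B cs es                         ≤⟨ T≤m ⟩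
        m                                     <⟨ n<1+n m ⟩
        suc m                                 ≡⟨ #cs ⟨
        length cs                             ∎)
  in  matching-∷ B p q B≡0 (matching-sparse m B cs′ es′ (length-∷ #cs p) (length-∷ #es q)
        (∸-monoˡ-≤ 1 (begin
          1 + total B cs′ es′
            ≤⟨ +-monoˡ-≤ _ (≤-trans 1≤col (m≤n+m _ (∑ es (B c)))) ⟩
          ∑ es (B c) + ∑ cs (λ c → B c e) + total B cs′ es′
            ≡⟨ total-remove B p q B≡0 ⟨
          total B cs es
            ≤⟨ T≤m ⟩
          m ∎)))
  where
  open ≤-Reasoning
  total′ = ∑ es (λ e → ∑ cs (λ c → B c e))
-- Every column vanishes, so any zero may be matched and the remaining total is 0.
... | inj₂ small =
  let cols≡0 = ∑-≡0 (All.map (s≤s⁻¹ ∘ ≰⇒>) small)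
      c , cs′ , p , B≡0 = extract-zero (λ c → B c e₀) cs (begin-strict
        ∑ cs (λ c → B c e₀)  ≡⟨ n≤0⇒n≡0 (≤-trans (m≤m+n _ _) (≤-reflexive cols≡0)) ⟩
        0                    <⟨ z<s ⟩
        suc m                ≡⟨ #cs ⟨
        length cs            ∎)
  in  matching-∷ B p refl B≡0 (matching-sparse m B cs′ es₀ (length-∷ #cs p) (suc-injective #es) (begin
        total B cs′ es₀  ≤⟨ m≤n+m (total B cs′ es₀) (∑ es (B c) + ∑ cs (λ c → B c e₀)) ⟩
        ∑ es (B c) + ∑ cs (λ c → B c e₀) + total B cs′ es₀
                         ≡⟨ total-remove B {es = es} {es′ = es₀} p refl B≡0 ⟨
        total B cs es    ≡⟨ ∑-swap B cs es ⟩
        _                ≡⟨ cols≡0 ⟩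
        0                ≤⟨ z≤n ⟩
        m ∸ 1            ∎))
  where open ≤-Reasoning

matching-flip : ∀ {B : I → J → ℕ} {cs es} → Matching (flip B) es cs → Matching B cs es
matching-flip {B = B} (ps , p , q , zs) =
  map Product.swap ps ,
  ↭-trans (↭-reflexive (sym (map-∘ ps))) q ,
  ↭-trans (↭-reflexive (sym (map-∘ ps))) p ,
  All.map⁺ zs

-- Deleting a zero entry on a line of sum at least m removes enough for the sparse case.
matching-heavy-row : ∀ m (B : I → J → ℕ) cs es → length cs ≡ suc m → length es ≡ suc m →
  total B cs es + 3 ≤ 2 * suc m → ∀ {c cs′} → cs ↭ c ∷ cs′ →
  m ≤ ∑ es (B c) → ∑ es (B c) < suc m → Matching B cs es
matching-heavy-row m B cs es #cs #es T≤ {c} {cs′} p m≤row row≤m =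
  let e , es′ , q , B≡0 = extract-zero (B c) es (<-≤-trans row≤m (≤-reflexive (sym #es)))
  in  matching-∷ B p q B≡0 (matching-sparse m B cs′ es′ (length-∷ #cs p) (length-∷ #es q)
        (bound m _ (begin
          m + total B cs′ es′ + 3
            ≤⟨ +-monoˡ-≤ 3 (+-monoˡ-≤ (total B cs′ es′) (≤-trans m≤row (m≤m+n _ (∑ cs (λ c → B c e))))) ⟩
          ∑ es (B c) + ∑ cs (λ c → B c e) + total B cs′ es′ + 3
            ≡⟨ cong (_+ 3) (total-remove B p q B≡0) ⟨
          total B cs es + 3
            ≤⟨ T≤ ⟩
          2 * suc m ∎)))
  where
  open ≤-Reasoning
  bound : ∀ m t → m + t + 3 ≤ 2 * suc m → t ≤ m ∸ 1
  bound m t le = ∸-monoˡ-≤ 1 (+-cancelˡ-≤ (m + 2) (suc t) m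
    (≤-trans (≤-reflexive (lhs m t)) (≤-trans le (≤-reflexive (rhs m)))))
    where
    lhs : ∀ m t → m + 2 + suc t ≡ m + t + 3
    lhs = solve-∀
    rhs : ∀ m → 2 * suc m ≡ m + 2 + m
    rhs = solve-∀

-- By König's theorem an n × n zero pattern without perfect matching contains an s × (n + 1 - s)
-- block of nonzero entries; 2n - 3 entries only allow s = 1 and s = n.
matching-dense : ∀ n (B : I → J → ℕ) cs es → length cs ≡ n → length es ≡ n →
  total B cs es + 3 ≤ 2 * n →
  All (λ c → ∑ es (B c) < n) cs → All (λ e → ∑ cs (λ c → B c e) < n) es →
  Matching B cs es
matching-dense zero    B cs es _ _ T≤ _ _ = contradiction (≤-trans (m≤n+m 3 _) T≤) λ ()
matching-dense (suc m) B cs es #cs #es T≤ rows cols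
  with extract (λ c → m ≤? ∑ es (B c)) cs
... | inj₁ (c , cs′ , p , m≤row) =
  matching-heavy-row m B cs es #cs #es T≤ p m≤row (All.head (All-resp-↭ p rows))
... | inj₂ rows<
  with extract (λ e → m ≤? ∑ cs (λ c → B c e)) es
... | inj₁ (e , es′ , q , m≤col) = matching-flip
  (matching-heavy-row m (flip B) es cs #es #cs
    (≤-trans (≤-reflexive (cong (_+ 3) (sym (∑-swap B cs es)))) T≤)
    q m≤col (All.head (All-resp-↭ q cols)))
... | inj₂ cols<
  with extract (λ e → 2 ≤? ∑ cs (λ c → B c e)) es
-- All line sums are below `m` here, as the induction hypothesis requires. Deleting a column of sum
-- at least 2 lowers the total by the 2 by which the bound drops.
... | inj₁ (e , es′ , q , 2≤col) =
  let c , cs′ , p , B≡0 = extract-zero (λ c → B c e) cs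
        (<-≤-trans (All.head (All-resp-↭ q cols)) (≤-reflexive (sym #cs)))
  in  matching-∷ B p q B≡0 (matching-dense m B cs′ es′ (length-∷ #cs p) (length-∷ #es q)
        (bound (begin
          total B cs′ es′ + 3 + 2
            ≡⟨ shuffle (total B cs′ es′) ⟩
          2 + total B cs′ es′ + 3
            ≤⟨ +-monoˡ-≤ 3 (+-monoˡ-≤ (total B cs′ es′) (≤-trans 2≤col (m≤n+m _ (∑ es (B c))))) ⟩
          ∑ es (B c) + ∑ cs (λ c → B c e) + total B cs′ es′ + 3
            ≡⟨ cong (_+ 3) (total-remove B p q B≡0) ⟨
          total B cs es + 3
            ≤⟨ T≤ ⟩
          2 * suc m ∎))
        (All.map (λ {c} lt → ≤-<-trans (rest (B c) q) (≰⇒> lt)) (All.tail (All-resp-↭ p rows<)))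
        (All.map (λ {e} lt → ≤-<-trans (rest (λ c → B c e) p) (≰⇒> lt)) (All.tail (All-resp-↭ q cols<))))
  where
  open ≤-Reasoning
  shuffle : ∀ t → t + 3 + 2 ≡ 2 + t + 3
  shuffle = solve-∀
  double : ∀ m → 2 * suc m ≡ 2 * m + 2
  double = solve-∀
  bound : ∀ {t} → t + 2 ≤ 2 * suc m → t ≤ 2 * m
  bound {t} le = +-cancelʳ-≤ 2 t (2 * m) (≤-trans le (≤-reflexive (double m)))
  rest : ∀ {A : Set} (f : A → ℕ) {x xs ys} → xs ↭ x ∷ ys → ∑ ys f ≤ ∑ xs f
  rest f p = ≤-trans (m≤n+m _ _) (≤-reflexive (sym (∑-↭ f p)))
-- Columns of sum at most 1 give a total of at most `suc m`. Only equality escapes the sparse case.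
... | inj₂ cols≤1
  with total B cs es ≤? m
... | yes T≤m = matching-sparse (suc m) B cs es #cs #es T≤m
... | no  T≰m
  with extract (λ c → 1 ≤? ∑ es (B c)) cs
... | inj₂ rows≡0 = contradiction
        (≤-trans (≤-reflexive (∑-≡0 (All.map (s≤s⁻¹ ∘ ≰⇒>) rows≡0))) z≤n) T≰m
... | inj₁ (c , cs′ , p , 1≤row)
  with extract-zero (B c) es (<-≤-trans (All.head (All-resp-↭ p rows)) (≤-reflexive (sym #es)))
... | e , es′ , q , B≡0
  with 1 ≤? ∑ cs (λ c → B c e)
-- A zero column would leave at most `m` for the other columns together.
... | no col≱1 = contradiction (begin
        total B cs es
          ≡⟨ ∑-swap B cs es ⟩
        ∑ es (λ e → ∑ cs (λ c → B c e))
          ≡⟨ ∑-↭ _ q ⟩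
        ∑ cs (λ c → B c e) + ∑ es′ (λ e → ∑ cs (λ c → B c e))
          ≤⟨ +-mono-≤ (s≤s⁻¹ (≰⇒> col≱1))
               (∑-≤-const (All.map (s≤s⁻¹ ∘ ≰⇒>) (All.tail (All-resp-↭ q cols≤1)))) ⟩
        length es′ * 1
          ≡⟨ *-identityʳ _ ⟩
        length es′
          ≡⟨ length-∷ #es q ⟩
        m ∎) T≰m
  where open ≤-Reasoning
-- The row and the column of this zero carry weight at least 2 together, so at most `m ∸ 1` remains.
... | yes 1≤col = matching-∷ B p q B≡0 (matching-sparse m B cs′ es′ (length-∷ #cs p) (length-∷ #es q)
        (∸-monoˡ-≤ 1 (s≤s⁻¹ (begin
          2 + total B cs′ es′
            ≤⟨ +-monoˡ-≤ (total B cs′ es′) (+-mono-≤ 1≤row 1≤col) ⟩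
          ∑ es (B c) + ∑ cs (λ c → B c e) + total B cs′ es′
            ≡⟨ total-remove B p q B≡0 ⟨
          total B cs es
            ≡⟨ ∑-swap B cs es ⟩
          ∑ es (λ e → ∑ cs (λ c → B c e))
            ≤⟨ ∑-≤-const (All.map (s≤s⁻¹ ∘ ≰⇒>) cols≤1) ⟩
          length es * 1
            ≡⟨ *-identityʳ _ ⟩
          length es
            ≡⟨ #es ⟩
          suc m ∎))))
  where open ≤-Reasoning

-- Sums over unordered pairs

pairSum : (A → A → ℕ) → List A → ℕ
pairSum f []       = 0
pairSum f (x ∷ xs) = ∑ xs (f x) + pairSum f xs

pairSum-↭ : ∀ {f : A → A → ℕ} → (∀ x y → f x y ≡ f y x) →
            ∀ {xs ys} → xs ↭ ys → pairSum f xs ≡ pairSum f ys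
pairSum-↭ f-sym refl       = ≡.refl
pairSum-↭ {f = f} f-sym (prep x p) = cong₂ _+_ (∑-↭ (f x) p) (pairSum-↭ f-sym p)
pairSum-↭ {f = f} f-sym {x ∷ y ∷ xs} {y ∷ x ∷ ys} (swap x y p)
  rewrite ∑-↭ (f x) p | ∑-↭ (f y) p | pairSum-↭ f-sym p | f-sym x y =
  interchange (f y x) (∑ ys (f x)) (∑ ys (f y)) (pairSum f ys)
pairSum-↭ f-sym (trans p q) = ≡.trans (pairSum-↭ f-sym p) (pairSum-↭ f-sym q)

pairSum-mono-≤ : ∀ {f g : A → A → ℕ} → (∀ x y → f x y ≤ g x y) → ∀ xs → pairSum f xs ≤ pairSum g xs
pairSum-mono-≤ le []       = z≤n
pairSum-mono-≤ le (x ∷ xs) =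
  +-mono-≤ (∑-mono-≤ (All.universal (le x) xs)) (pairSum-mono-≤ le xs)

pairSum-∑ : ∀ (f : I → A → A → ℕ) cs xs →
            pairSum (λ x y → ∑ cs (λ c → f c x y)) xs ≡ ∑ cs (λ c → pairSum (f c) xs)
pairSum-∑ f cs []       = sym (≡.trans (∑-const 0 cs) (*-zeroʳ (length cs)))
pairSum-∑ f cs (x ∷ xs) = ≡.trans
  (cong₂ _+_ (∑-swap (λ y c → f c x y) xs cs) (pairSum-∑ f cs xs))
  (sym (∑-+ (λ c → ∑ xs (f c x)) (λ c → pairSum (f c) xs) cs))

pairSum-+ : ∀ (f g : A → A → ℕ) xs → pairSum (λ x y → f x y + g x y) xs ≡ pairSum f xs + pairSum g xs
pairSum-+ f g []       = ≡.refl
pairSum-+ f g (x ∷ xs) = ≡.trans (cong₂ _+_ (∑-+ (f x) (g x) xs) (pairSum-+ f g xs))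
  (interchange (∑ xs (f x)) (∑ xs (g x)) (pairSum f xs) (pairSum g xs))

pairSum-cong : ∀ {f g : A → A → ℕ} → (∀ x y → f x y ≡ g x y) → ∀ xs → pairSum f xs ≡ pairSum g xs
pairSum-cong eq []       = ≡.refl
pairSum-cong eq (x ∷ xs) = cong₂ _+_ (∑-cong xs (eq x)) (pairSum-cong eq xs)

pairSum-1 : ∀ (xs : List A) → pairSum (λ _ _ → 1) xs ≡ length xs C 2
pairSum-1 []       = ≡.refl
pairSum-1 (x ∷ xs) = begin
  ∑ xs (λ _ → 1) + pairSum (λ _ _ → 1) xs  ≡⟨ cong₂ _+_ (≡.trans (∑-const 1 xs) (*-identityʳ _)) (pairSum-1 xs) ⟩
  length xs + length xs C 2                ≡⟨ cong (_+ length xs C 2) (nC1≡n (length xs)) ⟨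
  length xs C 1 + length xs C 2            ≡⟨ nCk+nC[k+1]≡[n+1]C[k+1] (length xs) 1 ⟩
  suc (length xs) C 2                      ∎
  where open ≡-Reasoning

-- Paths and closed tours

-- The list holds the inner vertices only. A closed tour is the case of equal ends, and cutting a
-- path at an inner vertex becomes concatenation.
pathEdges : A → List A → A → List (A × A)
pathEdges x []       y = [ x , y ]
pathEdges x (z ∷ zs) y = (x , z) ∷ pathEdges z zs y

pathWeight : (A → A → ℕ) → A → List A → A → ℕ
pathWeight f x xs y = ∑ (pathEdges x xs y) (uncurry f)

pathEdges-++ : ∀ (x : A) xs y ys z →
               pathEdges x (xs ++ y ∷ ys) z ≡ pathEdges x xs y ++ pathEdges y ys z
pathEdges-++ x []       y ys z = ≡.refl
pathEdges-++ x (w ∷ ws) y ys z = cong ((x , w) ∷_) (pathEdges-++ w ws y ys z)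

pathWeight-++ : ∀ (f : A → A → ℕ) x xs y ys z →
                pathWeight f x (xs ++ y ∷ ys) z ≡ pathWeight f x xs y + pathWeight f y ys z
pathWeight-++ f x xs y ys z =
  ≡.trans (cong (λ es → ∑ es (uncurry f)) (pathEdges-++ x xs y ys z)) (∑-++ (uncurry f) (pathEdges x xs y) _)

pathWeight-reverse : ∀ {f : A → A → ℕ} → (∀ x y → f x y ≡ f y x) →
                     ∀ x xs y → pathWeight f x (reverse xs) y ≡ pathWeight f y xs x
pathWeight-reverse f-sym x [] y = cong (_+ 0) (f-sym x y)
pathWeight-reverse {f = f} f-sym x (z ∷ zs) y = begin
  pathWeight f x (reverse (z ∷ zs)) y
    ≡⟨ cong (λ us → pathWeight f x us y) (unfold-reverse z zs) ⟩
  pathWeight f x (reverse zs ++ [ z ]) y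
    ≡⟨ pathWeight-++ f x (reverse zs) z [] y ⟩
  pathWeight f x (reverse zs) z + (f z y + 0)
    ≡⟨ cong₂ _+_ (pathWeight-reverse f-sym x zs z) (≡.trans (+-identityʳ _) (f-sym z y)) ⟩
  pathWeight f z zs x + f y z
    ≡⟨ +-comm _ (f y z) ⟩
  f y z + pathWeight f z zs x ∎
  where open ≡-Reasoning

-- Both tours consist of the same two arcs between `x` and `y`, in opposite order.
rotate-edges : ∀ (x : A) xs y ys → pathEdges y (ys ++ x ∷ xs) y ↭ pathEdges x (xs ++ y ∷ ys) x
rotate-edges x xs y ys
  rewrite pathEdges-++ y ys x xs y | pathEdges-++ x xs y ys x =
  ++-comm (pathEdges y ys x) (pathEdges x xs y)

module _ {P : A × A → Set} (P? : Decidable P) where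

  -- The last edge is kept apart from the others, and in both cases `a` is exposed as the last
  -- element of a list: this is the form in which a rotated tour shows its closing edge.
  find-edge : ∀ x xs y →
    All (¬_ ∘ P) (pathEdges x xs y)
    ⊎ (∃[ ls ] ∃[ a ] x ∷ xs ≡ ls ++ [ a ] × P (a , y))
    ⊎ (∃[ ls ] ∃[ a ] ∃[ as ] ∃[ b ] ∃[ bs ] xs ≡ as ++ b ∷ bs × x ∷ as ≡ ls ++ [ a ] × P (a , b))
  find-edge x [] y with P? (x , y)
  ... | yes p = inj₂ (inj₁ ([] , x , ≡.refl , p))
  ... | no ¬p = inj₁ (¬p ∷ [])
  find-edge x (z ∷ zs) y with P? (x , z) | find-edge z zs y
  ... | yes p | _ = inj₂ (inj₂ ([] , x , [] , z , zs , ≡.refl , ≡.refl , p))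
  ... | no ¬p | inj₁ ¬ps = inj₁ (¬p ∷ ¬ps)
  ... | no _  | inj₂ (inj₁ (ls , a , eq , p)) = inj₂ (inj₁ (x ∷ ls , a , cong (x ∷_) eq , p))
  ... | no _  | inj₂ (inj₂ (ls , a , as , b , bs , eq , eq′ , p)) =
    inj₂ (inj₂ (x ∷ ls , a , z ∷ as , b , bs , cong (z ∷_) eq , cong (x ∷_) eq′ , p))

  -- An inner edge from `a` to `b` becomes the closing edge once the tour starts at `b`.
  rotate-to-end : ∀ x xs →
    All (¬_ ∘ P) (pathEdges x xs x)
    ⊎ (∃[ z ] ∃[ zs ] z ∷ zs ↭ x ∷ xs × pathEdges z zs z ↭ pathEdges x xs x ×
       (∃[ ls ] ∃[ a ] z ∷ zs ≡ ls ++ [ a ] × P (a , z)))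
  rotate-to-end x xs with find-edge x xs x
  ... | inj₁ ¬ps = inj₁ ¬ps
  ... | inj₂ (inj₁ end) = inj₂ (x , xs , ↭-refl , ↭-refl , end)
  ... | inj₂ (inj₂ (ls , a , as , b , bs , ≡.refl , eq , p)) =
    inj₂ (b , bs ++ x ∷ as , ++-comm (b ∷ bs) (x ∷ as) , rotate-edges x as b bs ,
          b ∷ bs ++ ls , a , ≡.trans (cong (λ us → b ∷ bs ++ us) eq) (sym (++-assoc (b ∷ bs) ls [ a ])) , p)

-- Tours of at most average weight

below-average : ∀ (f : A → ℕ) x xs →
                ∃[ t ] t ∈ x ∷ xs × length (x ∷ xs) * f t ≤ ∑ (x ∷ xs) f
below-average f x [] = x , here ≡.refl , ≤-refl
below-average f x (y ∷ ys) with below-average f y ys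
... | t , t∈ , le with f x ≤? f t
...   | yes fx≤ft = x , here ≡.refl , +-monoʳ-≤ (f x) (≤-trans (*-monoʳ-≤ (length (y ∷ ys)) fx≤ft) le)
...   | no  fx≰ft = t , there t∈ , +-mono-≤ (≰⇒≥ fx≰ft) le

insertions : A → List A → List (List A)
insertions v []       = [ [ v ] ]
insertions v (x ∷ xs) = (v ∷ x ∷ xs) ∷ map (x ∷_) (insertions v xs)

insertions-↭ : ∀ (v : A) xs → All (_↭ v ∷ xs) (insertions v xs)
insertions-↭ v []       = refl ∷ []
insertions-↭ v (x ∷ xs) =
  refl ∷ All.map⁺ (All.map (λ p → trans (prep x p) (swap x v refl)) (insertions-↭ v xs))

length-insertions : ∀ (v : A) xs → length (insertions v xs) ≡ suc (length xs)
length-insertions v []       = ≡.refl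
length-insertions v (x ∷ xs) = cong suc (≡.trans (length-map (x ∷_) (insertions v xs)) (length-insertions v xs))

-- Each edge of the path is broken by exactly one insertion and survives the other `length xs` ones.
-- Over all insertions `v` is next to every inner vertex twice and to each end once.
∑-insertions : ∀ {f : A → A → ℕ} → (∀ x y → f x y ≡ f y x) → ∀ v x xs y →
  ∑ (insertions v xs) (λ us → pathWeight f x us y)
    ≡ length xs * pathWeight f x xs y + (f x v + f v y + 2 * ∑ xs (f v))
∑-insertions {f = f} f-sym v x [] y = lemma (f x v) (f v y)
  where
  lemma : ∀ a b → a + (b + 0) + 0 ≡ a + b + 0
  lemma = solve-∀
∑-insertions {f = f} f-sym v x (z ∷ zs) y = begin
  f x v + (f v z + w) + ∑ (map (z ∷_) (insertions v zs)) (λ us → pathWeight f x us y)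
    ≡⟨ cong (λ ns → f x v + (f v z + w) + sum ns) (map-∘ (insertions v zs)) ⟨
  f x v + (f v z + w) + ∑ (insertions v zs) (λ us → f x z + pathWeight f z us y)
    ≡⟨ cong (f x v + (f v z + w) +_) (∑-+ (λ _ → f x z) _ (insertions v zs)) ⟩
  f x v + (f v z + w) + (∑ (insertions v zs) (λ _ → f x z) + ∑ (insertions v zs) (λ us → pathWeight f z us y))
    ≡⟨ cong₂ (λ a b → f x v + (f v z + w) + (a + b))
         (≡.trans (∑-const (f x z) (insertions v zs)) (cong (_* f x z) (length-insertions v zs)))
         (≡.trans (∑-insertions f-sym v z zs y) (cong (λ a → length zs * w + (a + f v y + 2 * ∑ zs (f v))) (f-sym z v))) ⟩
  f x v + (f v z + w) + (suc (length zs) * f x z + (length zs * w + (f v z + f v y + 2 * ∑ zs (f v))))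
    ≡⟨ lemma (f x v) (f v z) w (length zs) (f x z) (f v y) (∑ zs (f v)) ⟩
  suc (length zs) * (f x z + w) + (f x v + f v y + 2 * (f v z + ∑ zs (f v))) ∎
  where
  open ≡-Reasoning
  w = pathWeight f z zs y
  lemma : ∀ xv vz w k xz vy s →
    xv + (vz + w) + (suc k * xz + (k * w + (vz + vy + 2 * s))) ≡ suc k * (xz + w) + (xv + vy + 2 * (vz + s))
  lemma = solve-∀

-- On n vertices a tour uses n of the n(n - 1)/2 pairs, so the bound is the average weight of a
-- tour. It is preserved when each new vertex is inserted at a place of at most average cost.
light-tour : ∀ {f : A → A → ℕ} → (∀ x y → f x y ≡ f y x) → ∀ x xs →
  ∃[ ys ] ys ↭ xs × length xs * pathWeight f x ys x ≤ 2 * pairSum f (x ∷ xs)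
light-tour f-sym x [] = [] , refl , z≤n
light-tour {A = A} {f = f} f-sym x (v ∷ vs) with light-tour f-sym x vs
... | ys , p , le with insertions v ys in eq | below-average (λ us → pathWeight f x us x)
... | [] | _ = contradiction (≡.trans (sym (length-insertions v ys)) (cong length eq)) λ ()
... | us ∷ uss | avg with avg us uss
... | t , t∈ , t≤ = t , trans (All.lookup t↭ t∈) (prep v p) , (begin
  suc (length vs) * pathWeight f x t x
    ≡⟨ cong (λ k → suc k * pathWeight f x t x) (↭-length p) ⟨
  suc (length ys) * pathWeight f x t x
    ≡⟨ cong (_* pathWeight f x t x) (length-insertions v ys) ⟨
  length (insertions v ys) * pathWeight f x t x
    ≡⟨ cong (λ l → length l * pathWeight f x t x) eq ⟩
  length (us ∷ uss) * pathWeight f x t x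
    ≤⟨ t≤ ⟩
  ∑ (us ∷ uss) (λ us → pathWeight f x us x)
    ≡⟨ cong (λ l → ∑ l (λ us → pathWeight f x us x)) eq ⟨
  ∑ (insertions v ys) (λ us → pathWeight f x us x)
    ≡⟨ ∑-insertions f-sym v x ys x ⟩
  length ys * pathWeight f x ys x + (f x v + f v x + 2 * ∑ ys (f v))
    ≡⟨ cong₂ (λ k a → k * pathWeight f x ys x + a) (↭-length p)
         (cong₂ (λ a s → f x v + a + 2 * s) (f-sym v x) (∑-↭ (f v) p)) ⟩
  length vs * pathWeight f x ys x + (f x v + f x v + 2 * ∑ vs (f v))
    ≤⟨ +-monoˡ-≤ _ le ⟩
  2 * (∑ vs (f x) + pairSum f vs) + (f x v + f x v + 2 * ∑ vs (f v))
    ≡⟨ lemma (∑ vs (f x)) (pairSum f vs) (f x v) (∑ vs (f v)) ⟩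
  2 * (f x v + ∑ vs (f x) + (∑ vs (f v) + pairSum f vs)) ∎)
  where
  open ≤-Reasoning
  t↭ : All (_↭ v ∷ ys) (us ∷ uss)
  t↭ = subst (All (_↭ v ∷ ys)) eq (insertions-↭ v ys)
  lemma : ∀ a b c d → 2 * (a + b) + (c + c + 2 * d) ≡ 2 * (c + a + (d + b))
  lemma = solve-∀

-- Removing heavy edges by exchanges

All-≤-∑ : ∀ (f : A → ℕ) xs → All (λ x → f x ≤ ∑ xs f) xs
All-≤-∑ f []       = []
All-≤-∑ f (x ∷ xs) = m≤m+n _ _ ∷ All.map (λ le → ≤-trans le (m≤n+m _ (f x))) (All-≤-∑ f xs)

-- The left side adds up `g p + h q` over the `length xs` consecutive pairs, together with `g` of
-- the last vertex, so the pairs cannot all cost `N` or more.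
cheap-adjacent-pair : ∀ (g h : A → ℕ) N x xs → ∑ (x ∷ xs) g + ∑ xs h < length xs * N →
  ∃[ ps ] ∃[ p ] ∃[ q ] ∃[ qs ] x ∷ xs ≡ ps ++ p ∷ q ∷ qs × g p + h q < N
cheap-adjacent-pair g h N x (y ∷ ys) lt with suc (g x + h y) ≤? N
... | yes cheap = [] , x , y , ys , ≡.refl , cheap
... | no costly =
  let ps , p , q , qs , eq , cheap = cheap-adjacent-pair g h N y ys (+-cancelˡ-< N _ _ (begin-strict
        N + (∑ (y ∷ ys) g + ∑ ys h)                ≤⟨ +-monoˡ-≤ _ (≮⇒≥ costly) ⟩
        (g x + h y) + (∑ (y ∷ ys) g + ∑ ys h)      ≡⟨ interchange (g x) (h y) (∑ (y ∷ ys) g) (∑ ys h) ⟩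
        ∑ (x ∷ y ∷ ys) g + ∑ (y ∷ ys) h            <⟨ lt ⟩
        length (y ∷ ys) * N                        ∎))
  in  x ∷ ps , p , q , qs , cong (x ∷_) eq , cheap
  where open ≤-Reasoning

module _ {f : A → A → ℕ} (f-sym : ∀ x y → f x y ≡ f y x) where

  -- Exchanges the closing edge ab and an edge pq of the tour for pa and qb, reversing the
  -- segment between q and a.
  two-opt : ∀ n b x xs a → n ≤ f a b →
    ∑ (x ∷ xs) (f a) + ∑ xs (f b) < length xs * n →
    pathWeight f b (x ∷ xs ++ [ a ]) b + 5 ≤ n + n →
    ∃[ ys ] ys ↭ x ∷ xs ++ [ a ] × pathWeight f b ys b + 5 ≤ n + n ×
      All (λ e → uncurry f e < n) (pathEdges b ys b)
  two-opt n b x xs a heavy sums≤ tour≤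
    with cheap-adjacent-pair (f a) (f b) n x xs sums≤
  ... | ps , p , q , qs , eq , cheap =
    ps ++ p ∷ a ∷ reverse qs ++ [ q ] , perm , new≤ ,
    subst (All _) (sym newEdges)
      (All.++⁺ (All.map (λ le → ≤-<-trans le X<n) (All-≤-∑ _ (pathEdges b ps p)))
        (pa<n ∷ All.++⁺ (All.map (λ le → ≤-<-trans le Y<n) (All-≤-∑ _ (pathEdges a (reverse qs) q)))
          (qb<n ∷ [])))
    where
    open ≤-Reasoning
    X = pathWeight f b ps p
    Y = pathWeight f a (reverse qs) q
    perm : ps ++ p ∷ a ∷ reverse qs ++ [ q ] ↭ x ∷ xs ++ [ a ]
    perm = ↭-trans
      (++⁺ˡ ps (prep p (↭-trans (prep a (↭-trans (++-comm (reverse qs) [ q ]) (prep q (↭-reverse qs))))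
        (++-comm [ a ] (q ∷ qs)))))
      (↭-reflexive (≡.trans (sym (++-assoc ps (p ∷ q ∷ qs) [ a ])) (cong (_++ [ a ]) (sym eq))))
    newEdges : pathEdges b (ps ++ p ∷ a ∷ reverse qs ++ [ q ]) b
             ≡ pathEdges b ps p ++ (p , a) ∷ pathEdges a (reverse qs) q ++ [ q , b ]
    newEdges = ≡.trans (pathEdges-++ b ps p _ b)
      (cong (λ es → pathEdges b ps p ++ (p , a) ∷ es) (pathEdges-++ a (reverse qs) q [] b))
    oldWeight : pathWeight f b (x ∷ xs ++ [ a ]) b ≡ X + (f p q + (Y + (f a b + 0)))
    oldWeight = ≡.trans
      (cong (λ us → pathWeight f b us b) (≡.trans (cong (_++ [ a ]) eq) (++-assoc ps (p ∷ q ∷ qs) [ a ])))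
      (≡.trans (pathWeight-++ f b ps p (q ∷ qs ++ [ a ]) b)
        (cong (λ w → X + (f p q + w)) (≡.trans (pathWeight-++ f q qs a [] b)
          (cong (_+ (f a b + 0)) (sym (pathWeight-reverse f-sym a qs q))))))
    newWeight : pathWeight f b (ps ++ p ∷ a ∷ reverse qs ++ [ q ]) b ≡ X + (f p a + (Y + (f q b + 0)))
    newWeight = ≡.trans (pathWeight-++ f b ps p (a ∷ reverse qs ++ [ q ]) b)
      (cong (λ w → X + (f p a + w)) (pathWeight-++ f a (reverse qs) q [] b))
    shuffle : ∀ x y s n → x + y + 5 + n + s ≡ x + (s + (y + (n + 0))) + 5
    shuffle = solve-∀
    shuffle′ : ∀ x y s t → x + (s + (y + (t + 0))) + 5 ≡ x + y + 5 + (s + t)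
    shuffle′ = solve-∀
    -- Of the old weight, at most 2n - 5, the closing edge `a` `b` accounts for at least n. The two
    -- arcs that are kept share what is left.
    rest≤ : X + Y + 5 ≤ n
    rest≤ = +-cancelʳ-≤ n _ _ (begin
      X + Y + 5 + n                      ≤⟨ +-monoʳ-≤ (X + Y + 5) heavy ⟩
      X + Y + 5 + f a b                  ≤⟨ m≤m+n _ (f p q) ⟩
      X + Y + 5 + f a b + f p q          ≡⟨ shuffle X Y (f p q) (f a b) ⟩
      X + (f p q + (Y + (f a b + 0))) + 5 ≡⟨ cong (_+ 5) oldWeight ⟨
      pathWeight f b (x ∷ xs ++ [ a ]) b + 5 ≤⟨ tour≤ ⟩
      n + n                              ∎)
    X+Y<n : X + Y < n
    X+Y<n = ≤-trans (m<m+n (X + Y) z<s) rest≤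
    X<n : X < n
    X<n = ≤-<-trans (m≤m+n X Y) X+Y<n
    Y<n : Y < n
    Y<n = ≤-<-trans (m≤n+m Y X) X+Y<n
    cheap′ : f p a + f q b < n
    cheap′ = subst (_< n) (cong₂ _+_ (f-sym a p) (f-sym b q)) cheap
    pa<n : f p a < n
    pa<n = ≤-<-trans (m≤m+n _ _) cheap′
    qb<n : f q b < n
    qb<n = ≤-<-trans (m≤n+m _ (f p a)) cheap′
    new≤ : pathWeight f b (ps ++ p ∷ a ∷ reverse qs ++ [ q ]) b + 5 ≤ n + n
    new≤ = begin
      pathWeight f b (ps ++ p ∷ a ∷ reverse qs ++ [ q ]) b + 5 ≡⟨ cong (_+ 5) newWeight ⟩
      X + (f p a + (Y + (f q b + 0))) + 5                       ≡⟨ shuffle′ X Y (f p a) (f q b) ⟩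
      X + Y + 5 + (f p a + f q b)                               ≤⟨ +-mono-≤ rest≤ (<⇒≤ cheap′) ⟩
      n + n                                                     ∎

  -- A heavy edge is first rotated into the closing position. Since it takes up part of the total
  -- weight k(3 + k), the k candidate exchanges cost less than 3 + k on average, so `two-opt`
  -- applies.
  avoid-heavy-edges : ∀ k x xs → length (x ∷ xs) ≡ 3 + k →
    pairSum f (x ∷ xs) ≤ k * (3 + k) →
    pathWeight f x xs x + 5 ≤ (3 + k) + (3 + k) →
    ∃[ y ] ∃[ ys ] y ∷ ys ↭ x ∷ xs × pathWeight f y ys y + 5 ≤ (3 + k) + (3 + k) ×
      All (λ e → uncurry f e < 3 + k) (pathEdges y ys y)
  avoid-heavy-edges k x xs #xs pairs≤ tour≤
    with rotate-to-end (λ e → 3 + k ≤? uncurry f e) x xs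
  ... | inj₁ light = x , xs , refl , tour≤ , All.map ≰⇒> light
  ... | inj₂ (z , zs , p , q , [] , a , ≡.refl , heavy) =
    contradiction (≡.trans (↭-length p) #xs) λ ()
  ... | inj₂ (z , zs , p , q , _ ∷ [] , a , ≡.refl , heavy) =
    contradiction (≡.trans (↭-length p) #xs) λ ()
  ... | inj₂ (b , .(m ∷ ms ++ [ a ]) , p , q , _ ∷ m ∷ ms , a , ≡.refl , heavy) =
    let ys , r , w≤ , light = two-opt (3 + k) b m ms a heavy sums≤
          (subst (λ w → w + 5 ≤ _) (sym (∑-↭ (uncurry f) q)) tour≤)
    in  b , ys , trans (prep b r) p , w≤ , light
    where
    open ≤-Reasoning
    #ms : length ms ≡ k
    #ms = suc-injective (suc-injective (suc-injective (≡.trans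
      (sym (cong (2 +_) (≡.trans (length-++ ms) (+-comm (length ms) 1))))
      (≡.trans (↭-length p) #xs))))
    shuffle : ∀ s a t b d → s + t + a ≤ a + (b + t) + (s + d)
    shuffle s a t b d = ≤-trans (m≤m+n _ (b + d)) (≤-reflexive (lemma s a t b d))
      where
      lemma : ∀ s a t b d → s + t + a + (b + d) ≡ a + (b + t) + (s + d)
      lemma = solve-∀
    -- The pairs summed on the left are distinct and differ from `a` `b`. The positive weight of `a`
    -- `b` makes the inequality strict.
    sums≤ : ∑ (m ∷ ms) (f a) + ∑ ms (f b) < length ms * (3 + k)
    sums≤ = begin-strict
      ∑ (m ∷ ms) (f a) + ∑ ms (f b)
        <⟨ m<m+n _ (<-≤-trans z<s heavy) ⟩
      ∑ (m ∷ ms) (f a) + ∑ ms (f b) + f a b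
        ≡⟨ cong (∑ (m ∷ ms) (f a) + ∑ ms (f b) +_) (f-sym a b) ⟩
      ∑ (m ∷ ms) (f a) + ∑ ms (f b) + f b a
        ≤⟨ shuffle (∑ (m ∷ ms) (f a)) (f b a) (∑ ms (f b)) (f b m) (pairSum f (m ∷ ms)) ⟩
      pairSum f (b ∷ a ∷ m ∷ ms)
        ≡⟨ pairSum-↭ f-sym (prep b (++-comm [ a ] (m ∷ ms))) ⟩
      pairSum f (b ∷ m ∷ ms ++ [ a ])
        ≡⟨ pairSum-↭ f-sym p ⟩
      pairSum f (x ∷ xs)
        ≤⟨ pairs≤ ⟩
      k * (3 + k)
        ≡⟨ cong (_* (3 + k)) #ms ⟨
      length ms * (3 + k) ∎

  -- The edge into the end `x` is found in the first sum, all earlier edges among the pairs of the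
  -- list.
  path-≤-pairSum : ∀ x z t ts →
    pathWeight f z (t ∷ ts) x ≤ ∑ (t ∷ ts) (f x) + pairSum f (z ∷ t ∷ ts)
  path-≤-pairSum x z t [] = begin
    f z t + (f t x + 0)                       ≡⟨ cong (λ w → f z t + (w + 0)) (f-sym t x) ⟩
    f z t + (f x t + 0)                       ≡⟨ lemma (f z t) (f x t) ⟩
    f x t + 0 + (f z t + 0 + 0)               ∎
    where
    open ≤-Reasoning
    lemma : ∀ a b → a + (b + 0) ≡ b + 0 + (a + 0 + 0)
    lemma = solve-∀
  path-≤-pairSum x z t (u ∷ us) = begin
    f z t + pathWeight f t (u ∷ us) x
      ≤⟨ +-monoʳ-≤ (f z t) (path-≤-pairSum x t u us) ⟩
    f z t + (∑ (u ∷ us) (f x) + pairSum f (t ∷ u ∷ us))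
      ≤⟨ m≤n+m _ (f x t + ∑ (u ∷ us) (f z)) ⟩
    (f x t + ∑ (u ∷ us) (f z)) + (f z t + (∑ (u ∷ us) (f x) + pairSum f (t ∷ u ∷ us)))
      ≡⟨ lemma (f x t) (∑ (u ∷ us) (f z)) (f z t) (∑ (u ∷ us) (f x)) (pairSum f (t ∷ u ∷ us)) ⟩
    f x t + ∑ (u ∷ us) (f x) + (f z t + ∑ (u ∷ us) (f z) + pairSum f (t ∷ u ∷ us)) ∎
    where
    open ≤-Reasoning
    lemma : ∀ a b c d e → (a + b) + (c + (d + e)) ≡ a + d + (c + b + e)
    lemma = solve-∀

  -- From three vertices on, the edges of a closed tour are distinct pairs. On two vertices the only
  -- pair would be traversed twice.
  tour-≤-pairSum : ∀ x xs → 3 ≤ length (x ∷ xs) → pathWeight f x xs x ≤ pairSum f (x ∷ xs)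
  tour-≤-pairSum x (z ∷ []) (s≤s (s≤s ()))
  tour-≤-pairSum x (z ∷ t ∷ ts) _ = ≤-trans (+-monoʳ-≤ (f x z) (path-≤-pairSum x z t ts))
    (≤-reflexive (sym (+-assoc (f x z) (∑ (t ∷ ts) (f x)) _)))

-- The average tour weight is at most 2k(3 + k)/(2 + k), which is below 2k + 2. By integrality a
-- light tour weighs at most 2k + 1, that is 2n - 5 for n = 3 + k.
good-tour : ∀ {f : A → A → ℕ} → (∀ x y → f x y ≡ f y x) → ∀ k xs → length xs ≡ 3 + k →
  pairSum f xs ≤ k * (3 + k) →
  ∃[ y ] ∃[ ys ] y ∷ ys ↭ xs × pathWeight f y ys y + 5 ≤ (3 + k) + (3 + k) ×
    All (λ e → uncurry f e < 3 + k) (pathEdges y ys y)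
good-tour {f = f} f-sym k (x ∷ xs) #xs pairs≤ =
  let ys , p , light = light-tour f-sym x xs
      z , zs , q , good = avoid-heavy-edges f-sym k x ys
        (≡.trans (cong suc (↭-length p)) #xs)
        (≤-trans (≤-reflexive (pairSum-↭ f-sym (prep x p))) pairs≤)
        (average (≤-trans
          (≤-trans (≤-reflexive (cong (_* pathWeight f x ys x) (sym (suc-injective #xs)))) light)
          (*-monoʳ-≤ 2 pairs≤)))
  in  z , zs , ↭-trans q (prep x p) , good
  where
  average : ∀ {c} → (2 + k) * c ≤ 2 * (k * (3 + k)) → c + 5 ≤ (3 + k) + (3 + k)
  average {c} le = ≤-trans (≤-reflexive (+-comm c 5)) (≤-trans (+-monoʳ-≤ 4 c<) (≤-reflexive (lemma k)))
    where
    lemma : ∀ k → 4 + (2 + 2 * k) ≡ 3 + k + (3 + k)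
    lemma = solve-∀
    lemma′ : ∀ k → 4 + 2 * (k * (3 + k)) ≡ (2 + k) * (2 + 2 * k)
    lemma′ = solve-∀
    -- (2 + k)(2 + 2k) exceeds 2k(3 + k) by exactly 4.
    c< : c < 2 + 2 * k
    c< = *-cancelˡ-< (2 + k) _ _ (≤-<-trans le
      (≤-trans (s≤s (m≤n+m _ 3)) (≤-reflexive (lemma′ k))))

-- Counting edges

indicator : ∀ {P : Set} → Dec P → ℕ
indicator P? = if does P? then 1 else 0

length-filter : ∀ {P : A → Set} (P? : Decidable P) xs → length (filter P? xs) ≡ ∑ xs (indicator ∘ P?)
length-filter P? []       = ≡.refl
length-filter P? (x ∷ xs) with does (P? x)
... | true  = cong suc (length-filter P? xs)
... | false = length-filter P? xs

∑-cartesianProduct : ∀ (f : A × I → ℕ) xs ys →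
                     ∑ (cartesianProduct xs ys) f ≡ ∑ xs (λ x → ∑ ys (λ y → f (x , y)))
∑-cartesianProduct f []       ys = ≡.refl
∑-cartesianProduct f (x ∷ xs) ys = ≡.trans (∑-++ f (map (x ,_) ys) _)
  (cong₂ _+_ (cong sum (sym (map-∘ ys))) (∑-cartesianProduct f xs ys))

-- In an increasing list `f` vanishes on the diagonal and on all pairs against the list order, so
-- only the pairs counted by `pairSum` survive.
∑∑-increasing-≤-pairSum : ∀ (f : Fin n → Fin n → ℕ) → (∀ {u v} → ¬ u Fin.< v → f u v ≤ 0) →
  ∀ {xs} → AllPairs Fin._<_ xs → ∑ xs (λ u → ∑ xs (f u)) ≤ pairSum f xs
∑∑-increasing-≤-pairSum f f≤0 [] = z≤n
∑∑-increasing-≤-pairSum f f≤0 {x ∷ xs} (x< ∷ <xs) = begin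
  f x x + ∑ xs (f x) + ∑ xs (λ u → f u x + ∑ xs (f u))
    ≡⟨ cong (f x x + ∑ xs (f x) +_) (∑-+ (λ u → f u x) _ xs) ⟩
  f x x + ∑ xs (f x) + (∑ xs (λ u → f u x) + ∑ xs (λ u → ∑ xs (f u)))
    ≤⟨ +-mono-≤ (+-monoˡ-≤ (∑ xs (f x)) (f≤0 (Fin.<-irrefl ≡.refl)))
         (+-mono-≤ (≤-reflexive (∑-≡0 (All.map (f≤0 ∘ Fin.<-asym) x<))) (∑∑-increasing-≤-pairSum f f≤0 <xs)) ⟩
  ∑ xs (f x) + pairSum f xs ∎
  where open ≤-Reasoning

module _ (G : Graph n) where
  open Graph G using (Adj; adj?)

  present absent : Fin n → Fin n → ℕ
  present u v = indicator (adj? u v)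
  absent  u v = indicator (¬? (adj? u v))

  absent-sym : ∀ u v → absent u v ≡ absent v u
  absent-sym u v with adj? u v | adj? v u
  ... | yes _  | yes _  = ≡.refl
  ... | no _   | no _   = ≡.refl
  ... | yes uv | no ¬vu = contradiction (Graph.sym G uv) ¬vu
  ... | no ¬uv | yes vu = contradiction (Graph.sym G vu) ¬uv

  absent≡0⇒Adj : ∀ u v → absent u v ≡ 0 → Adj u v
  absent≡0⇒Adj u v eq with adj? u v
  ... | yes uv = uv

  e-≤-pairSum : e G ≤ pairSum present (allFin n)
  e-≤-pairSum = begin
    e G
      ≡⟨ length-filter (λ p → (proj₁ p Fin.<? proj₂ p) ×-dec adj? (proj₁ p) (proj₂ p))
           (cartesianProduct (allFin n) (allFin n)) ⟩
    ∑ (cartesianProduct (allFin n) (allFin n)) (uncurry increasing)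
      ≡⟨ ∑-cartesianProduct (uncurry increasing) (allFin n) (allFin n) ⟩
    ∑ (allFin n) (λ u → ∑ (allFin n) (increasing u))
      ≤⟨ ∑∑-increasing-≤-pairSum increasing vanishes (AllPairs.tabulate⁺-< id) ⟩
    pairSum increasing (allFin n)
      ≤⟨ pairSum-mono-≤ increasing≤ (allFin n) ⟩
    pairSum present (allFin n) ∎
    where
    open ≤-Reasoning
    increasing : Fin n → Fin n → ℕ
    increasing u v = indicator ((u Fin.<? v) ×-dec adj? u v)
    vanishes : ∀ {u v} → ¬ u Fin.< v → increasing u v ≤ 0
    vanishes {u} {v} u≮v rewrite dec-false (u Fin.<? v) u≮v = z≤n
    increasing≤ : ∀ u v → increasing u v ≤ present u v
    increasing≤ u v with does (u Fin.<? v)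
    ... | true  = ≤-refl
    ... | false = z≤n

  -- Passing from n - 1 to n vertices adds n - 1 pairs. With at least 2 edges beyond the pairs on n
  -- - 1 vertices, at most n - 3 pairs are missing.
  few-absent : (n ∸ 1) C 2 + 1 < e G → pairSum absent (allFin n) + 3 ≤ n
  few-absent = bound n e-≤-pairSum (begin-equality
      pairSum present (allFin n) + pairSum absent (allFin n)
        ≡⟨ pairSum-+ present absent (allFin n) ⟨
      pairSum (λ u v → present u v + absent u v) (allFin n)
        ≡⟨ pairSum-cong sum≡1 (allFin n) ⟩
      pairSum (λ _ _ → 1) (allFin n)
        ≡⟨ pairSum-1 (allFin n) ⟩
      length (allFin n) C 2
        ≡⟨ cong (_C 2) (length-tabulate {n = n} id) ⟩
      n C 2 ∎)
    where
    open ≤-Reasoning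
    sum≡1 : ∀ u v → present u v + absent u v ≡ 1
    sum≡1 u v with does (adj? u v)
    ... | true  = ≡.refl
    ... | false = ≡.refl
    bound : ∀ n {e p a} → e ≤ p → p + a ≡ n C 2 → (n ∸ 1) C 2 + 1 < e → a + 3 ≤ n
    bound zero e≤p eq lt = contradiction (≤-trans lt (≤-trans e≤p (≤-trans (m≤m+n _ _) (≤-reflexive eq)))) λ ()
    bound (suc m) {e} {p} {a} e≤p eq lt = ≤-trans (≤-reflexive (+-comm a 3)) (s≤s (+-cancelˡ-≤ (m C 2) _ _ (begin
      m C 2 + (2 + a)        ≡⟨ shuffle (m C 2) a ⟩
      suc (m C 2 + 1) + a    ≤⟨ +-monoˡ-≤ a (≤-trans lt e≤p) ⟩
      p + a                  ≡⟨ eq ⟩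
      suc m C 2              ≡⟨ nCk+nC[k+1]≡[n+1]C[k+1] m 1 ⟨
      m C 1 + m C 2          ≡⟨ cong (_+ m C 2) (nC1≡n m) ⟩
      m + m C 2              ≡⟨ +-comm m _ ⟩
      m C 2 + m              ∎)))
      where
      shuffle : ∀ c a → c + (2 + a) ≡ suc (c + 1) + a
      shuffle = solve-∀

-- From lists to permutations

fromList : ∀ (xs : List A) → length xs ≡ n → ∃[ f ] tabulate {n = n} f ≡ xs
fromList xs ≡.refl = lookup xs , tabulate-lookup xs

tabulate-injective : ∀ (f : Fin m → A) → Unique (tabulate f) → ∀ i j → f i ≡ f j → i ≡ j
tabulate-injective f _           zero    zero    _  = ≡.refl
tabulate-injective f (f0≢ ∷ _)  zero    (suc j) eq = contradiction eq (All.tabulate⁻ f0≢ j)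
tabulate-injective f (f0≢ ∷ _)  (suc i) zero    eq = contradiction (sym eq) (All.tabulate⁻ f0≢ i)
tabulate-injective f (_ ∷ uniq) (suc i) (suc j) eq = cong suc (tabulate-injective (f ∘ suc) uniq i j eq)

-- The rearrangement makes `f` surjective, as every index occurs in the list, and injective, as
-- `allFin n` has no repetitions.
toPermutation : ∀ (f : Fin n → Fin n) → tabulate f ↭ allFin n →
                ∃[ π ] (∀ i → π ⟨$⟩ʳ i ≡ f i)
toPermutation {n} f p = permutation f g f∘g (λ i → tabulate-injective f uniq _ i (f∘g (f i))) , λ _ → ≡.refl
  where
  preimage : ∀ i → ∃[ j ] i ≡ f j
  preimage i = ∈-tabulate⁻ (∈-resp-↭ (↭-sym p) (∈-allFin i))
  g : Fin n → Fin n
  g = proj₁ ∘ preimage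
  f∘g : ∀ i → f (g i) ≡ i
  f∘g i = sym (proj₂ (preimage i))
  uniq : Unique (tabulate f)
  uniq = Permutationₛ.Unique-resp-↭ (≡.setoid (Fin n)) (↭⇒↭ₛ (↭-sym p)) (allFin⁺ n)

All-tabulate₂ : ∀ {R : I → J → Set} (f : Fin n → I) (g : Fin n → J) ps →
  tabulate f ≡ map proj₁ ps → tabulate g ≡ map proj₂ ps →
  All (λ p → R (proj₁ p) (proj₂ p)) ps → ∀ i → R (f i) (g i)
All-tabulate₂ {n = suc n} {R = R} f g (p ∷ ps) eq eq′ (r ∷ rs) i
  with ∷-injective eq | ∷-injective eq′
... | ≡.refl , eqs | ≡.refl , eqs′ with i
... | zero  = r
... | suc i = All-tabulate₂ {R = R} (f ∘ suc) (g ∘ suc) ps eqs eqs′ rs i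

matching⇒permutation : ∀ (B : Fin n → Fin n → ℕ) → Matching B (allFin n) (allFin n) →
                       ∃[ π ] (∀ i → B i (π ⟨$⟩ʳ i) ≡ 0)
matching⇒permutation {n} B (ps , p , q , zs)
  with f , f≡ ← fromList (map proj₁ ps) (≡.trans (↭-length p) (length-tabulate {n = n} id))
     | g , g≡ ← fromList (map proj₂ ps) (≡.trans (↭-length q) (length-tabulate {n = n} id))
  with σ , σ≡ ← toPermutation f (↭-trans (↭-reflexive f≡) p)
     | τ , τ≡ ← toPermutation g (↭-trans (↭-reflexive g≡) q) =
  -- `σ` and `τ` list the rows and columns of the matched pairs. Row `i` stands at position
  -- `σ ⟨$⟩ˡ i`, and `τ` gives the column there.
  Perm.flip σ ∘ₚ τ , λ i → ≡.trans
    (cong₂ B (≡.trans (sym (inverseʳ σ)) (σ≡ _)) (τ≡ _))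
    (All-tabulate₂ {R = λ c e → B c e ≡ 0} f g ps f≡ g≡ zs (σ ⟨$⟩ˡ i))

-- Edges of a tour as a function of the position

next-inject₁ : ∀ (i : Fin m) → next (inject₁ i) ≡ suc i
next-inject₁ {m} i = Fin.toℕ-injective (≡.trans (Fin.toℕ-fromℕ< _)
  (≡.trans (m<n⇒m%n≡m (s≤s (subst (_< m) (sym (Fin.toℕ-inject₁ i)) (Fin.toℕ<n i))))
    (cong suc (Fin.toℕ-inject₁ i))))

next-fromℕ : ∀ m → next (fromℕ m) ≡ zero
next-fromℕ m = Fin.toℕ-injective (≡.trans (Fin.toℕ-fromℕ< _)
  (≡.trans (cong (λ k → suc k % suc m) (Fin.toℕ-fromℕ m)) (n%n≡0 (suc m))))

-- `g` stands for `f ∘ next`. As `next` wraps around and does not restrict along `suc`, the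
-- induction keeps only the values of `g` at the inner positions and at the last one.
pathEdges-tabulate : ∀ m (f g : Fin (suc m) → A) {y} → (∀ i → g (inject₁ i) ≡ f (suc i)) → g (fromℕ m) ≡ y →
  pathEdges (f zero) (tabulate (f ∘ suc)) y ≡ tabulate (λ i → f i , g i)
pathEdges-tabulate zero    f g _  ≡.refl = ≡.refl
pathEdges-tabulate (suc m) f g eq eq′ = cong₂ _∷_ (cong (f zero ,_) (sym (eq zero)))
  (pathEdges-tabulate m (f ∘ suc) (g ∘ suc) (eq ∘ suc) eq′)

tourEdges-tabulate : ∀ (f : Fin n → A) {x xs} → tabulate f ≡ x ∷ xs →
  pathEdges x xs x ≡ tabulate (λ i → f i , f (next i))
tourEdges-tabulate {n = suc m} f ≡.refl =
  pathEdges-tabulate m f (f ∘ next) (λ i → cong f (next-inject₁ i)) (cong f (next-fromℕ m))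

-- Labelling the tour with the graphs

-- The equation n ≡ 3 + k is only propositional, so that allFin n does not unfold.
module _ {n : ℕ} (k : ℕ) (n≡3+k : n ≡ 3 + k) (G : Fin n → Graph n)
         (few : ∀ i → pairSum (absent (G i)) (allFin n) + 3 ≤ n) where

  private
    w : Fin n → Fin n → ℕ
    w u v = ∑ (allFin n) (λ i → absent (G i) u v)

    w-sym : ∀ u v → w u v ≡ w v u
    w-sym u v = ∑-cong (allFin n) (λ i → absent-sym (G i) u v)

    absent≤k : ∀ i → pairSum (absent (G i)) (allFin n) ≤ k
    absent≤k i = +-cancelʳ-≤ 3 _ _ (≤-trans (few i) (≤-reflexive (≡.trans n≡3+k (+-comm 3 k))))

    #allFin : length (allFin n) ≡ n
    #allFin = length-tabulate {n = n} id

    pairSum-w : pairSum w (allFin n) ≤ k * (3 + k)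
    pairSum-w = begin
      pairSum w (allFin n)                                  ≡⟨ pairSum-∑ (λ i → absent (G i)) (allFin n) (allFin n) ⟩
      ∑ (allFin n) (λ i → pairSum (absent (G i)) (allFin n)) ≤⟨ ∑-≤-const (All.universal absent≤k (allFin n)) ⟩
      length (allFin n) * k                                 ≡⟨ cong (_* k) (≡.trans #allFin n≡3+k) ⟩
      (3 + k) * k                                           ≡⟨ *-comm (3 + k) k ⟩
      k * (3 + k)                                           ∎
      where open ≤-Reasoning

    3≤n : 3 ≤ n
    3≤n = ≤-trans (m≤m+n 3 k) (≤-reflexive (sym n≡3+k))

    module _ (x : Fin n) (xs : List (Fin n)) (p : x ∷ xs ↭ allFin n)
             (tour≤ : pathWeight w x xs x + 5 ≤ (3 + k) + (3 + k))
             (light : All (λ e → uncurry w e < 3 + k) (pathEdges x xs x))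
             (π : Permutation′ n) (tour≡ : tabulate (π ⟨$⟩ʳ_) ≡ x ∷ xs) where

      cycle : HamiltonianCycle n
      cycle = record { 3≤n = 3≤n ; order = π }

      open HamiltonianCycle cycle using (edge)
      open ≤-Reasoning

      -- Rows are graphs and columns are positions on the tour. A zero means that the graph contains
      -- the edge at that position.
      B : Fin n → Fin n → ℕ
      B i j = uncurry (absent (G i)) (edge j)

      edges≡ : pathEdges x xs x ≡ map edge (allFin n)
      edges≡ = ≡.trans (tourEdges-tabulate (π ⟨$⟩ʳ_) tour≡) (sym (map-tabulate id edge))

      ∑-edges : ∀ g → ∑ (pathEdges x xs x) g ≡ ∑ (allFin n) (g ∘ edge)
      ∑-edges g = ≡.trans (cong (λ es → ∑ es g) edges≡) (cong sum (sym (map-∘ (allFin n))))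

      total≤ : total B (allFin n) (allFin n) + 3 ≤ 2 * n
      total≤ = begin
        total B (allFin n) (allFin n) + 3        ≡⟨ cong (_+ 3) (∑-swap B (allFin n) (allFin n)) ⟩
        ∑ (allFin n) (uncurry w ∘ edge) + 3      ≡⟨ cong (_+ 3) (∑-edges (uncurry w)) ⟨
        pathWeight w x xs x + 3                  ≤⟨ +-monoʳ-≤ _ (m≤m+n 3 2) ⟩
        pathWeight w x xs x + 5                  ≤⟨ tour≤ ⟩
        (3 + k) + (3 + k)                        ≡⟨ cong₂ _+_ n≡3+k n≡3+k ⟨
        n + n                                    ≡⟨ cong (n +_) (+-identityʳ n) ⟨
        2 * n                                    ∎

      -- A graph misses at most n - 3 pairs in all, too few to miss every edge of the tour.
      row : ∀ i → ∑ (allFin n) (B i) < n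
      row i = begin-strict
        ∑ (allFin n) (B i)                       ≡⟨ ∑-edges (uncurry (absent (G i))) ⟨
        pathWeight (absent (G i)) x xs x         ≤⟨ tour-≤-pairSum (absent-sym (G i)) x xs
                                                      (≤-trans 3≤n (≤-reflexive (sym (≡.trans (↭-length p) #allFin)))) ⟩
        pairSum (absent (G i)) (x ∷ xs)          ≡⟨ pairSum-↭ (absent-sym (G i)) p ⟩
        pairSum (absent (G i)) (allFin n)        ≤⟨ absent≤k i ⟩
        k                                        <⟨ m<n+m k z<s ⟩
        3 + k                                    ≡⟨ n≡3+k ⟨
        n                                        ∎

      -- The sum of column `j` is the weight of the edge at position `j`, and the tour has no edge
      -- of weight n.
      column : All (λ j → ∑ (allFin n) (λ i → B i j) < n) (allFin n)
      column = All.map⁻ (subst (All _) edges≡ (All.map (λ lt → <-≤-trans lt (≤-reflexive (sym n≡3+k))) light))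

      labels : ∃[ τ ] (∀ i → B i (τ ⟨$⟩ʳ i) ≡ 0)
      labels = matching⇒permutation B
        (matching-dense n B (allFin n) (allFin n) #allFin #allFin total≤ (All.universal row (allFin n)) column)

      label-tour : RainbowHamiltonianCycle G
      label-tour = record
        { cycle    = cycle
        ; labeling = proj₁ labels
        ; rainbow  = λ i → absent≡0⇒Adj (G i) _ _ (proj₂ labels i)
        }

  rainbowHamiltonianCycle : RainbowHamiltonianCycle G
  rainbowHamiltonianCycle =
    let x , xs , p , tour≤ , light = good-tour w-sym k (allFin n) (≡.trans #allFin n≡3+k) pairSum-w
        f , f≡ = fromList (x ∷ xs) (≡.trans (↭-length p) #allFin)
        π , π≡ = toPermutation f (↭-trans (↭-reflexive f≡) p)
    in  label-tour x xs p tour≤ light π (≡.trans (tabulate-cong π≡) f≡)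

mainTheorem1 : ∀ (n : ℕ) → 4 ≤ n → (G : Fin n → Graph n) →
    (∀ i → ((n ∸ 1) C 2) + 1 < e (G i)) →
    RainbowHamiltonianCycle G
mainTheorem1 _ (s≤s (s≤s (s≤s {n = k} _))) G many =
  rainbowHamiltonianCycle k ≡.refl G (λ i → few-absent (G i) (many i))
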